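{- There exist rooted trees $T_1,T_2$, a largest common minor $T_\mu$ of $T_1$ and $T_2$, and minor embeddings $g_1:T_\mu\to T_1$, $g_2:T_\mu\to T_2$, such that the join $T_{po}$ of $T_1$ and $T_2$ obtained through $g_1$ and $g_2$ contains nodes $v,w\in V(T_{po})$ and two different directed paths from $v$ to $w$ without any common intermediate node, neither of which is the arc $(v,w)$.
   Context: A (rooted) tree is a finite directed graph $T=(V(T),E(T))$, without loops, which is either empty or has a distinguished node $r$ (the root) such that for every other node $v$ there is exactly one directed path from $r$ to $v$. The size of $T$ is the number of its nodes. A tree $S$ is a minor of a tree $T$ if there is an injective map $f:V(S)\to V(T)$ (a minor embedding $f:S\to T$) such that for every arc $(u,v)\in E(S)$ there is a directed path from $f(u)$ to $f(v)$ in $T$ with no intermediate node in $f(V(S))$. A largest common minor of $T_1,T_2$ is a tree that is a minor of both and has the largest size among all such trees. Given $T_1,T_2,T_\mu,g_1,g_2$, let $\theta$ be the equivalence relation on the disjoint union $V(T_1)\sqcup V(T_2)$ defined, up to symmetry, by: $(a,b)\in\theta$ if and only if $a=b$ or there is $c\in V(T_\mu)$ with $a=g_1(c)$ and $b=g_2(c)$. The join $T_{po}$ is the directed graph with node set $(V(T_1)\sqcup V(T_2))/\theta$, in which $([a],[b])$ is an arc if and only if there exist $a'\in[a]$, $b'\in[b]$ and $i\in\{1,2\}$ with $(a',b')\in E(T_i)$. The intermediate nodes of a path $(v_0,v_1,\dots,v_k)$ are $v_1,\dots,v_{k-1}$. -}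

module Defs where

open import Data.Fin.Base using (Fin)
open import Data.List.Base using (List; []; _∷_)
open import Data.List.Relation.Binary.Disjoint.Setoid using (Disjoint)
open import Data.List.Relation.Binary.Pointwise.Base using (Pointwise)
open import Data.List.Relation.Unary.All using (All)
open import Data.Nat.Base using (ℕ; _≤_)
open import Data.Product.Base using (Σ-syntax; ∃-syntax; _×_; _,_)
open import Data.Sum.Base using (_⊎_; inj₁; inj₂)
import Data.Sum.Relation.Binary.Pointwise as Sum
open import Function.Bundles using (Injection; Inverse)
open import Level using (0ℓ)
open import Relation.Binary.Bundles using (Setoid)
open import Relation.Binary.Core using (Rel)
open import Relation.Binary.Definitions using (Irreflexive; _Respects₂_)
open import Relation.Binary.PropositionalEquality using (setoid)
open import Relation.Nullary.Negation using (¬_)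

-- The nodes form a setoid because the node set of a join is a quotient.
record Digraph : Set₁ where
  infix 4 _⟶_
  field
    nodes : Setoid 0ℓ 0ℓ
  open Setoid nodes public renaming (Carrier to V)
  field
    _⟶_    : Rel V 0ℓ
    ⟶-resp : _⟶_ Respects₂ _≈_

  -- Path u v consists of the node sequences (v₀ , … , vₖ), k ≥ 0, from u to v
  -- whose successive nodes are joined by arcs; nodes may repeat.
  infixr 5 _∷_
  data Path : V → V → Set where
    [_] : ∀ {u v} → u ≈ v → Path u v
    _∷_ : ∀ {u v w} → u ⟶ v → Path v w → Path u w

  sequence : ∀ {u v} → Path u v → List V
  sequence {u} [ _ ]   = u ∷ []
  sequence {u} (_ ∷ p) = u ∷ sequence p

  -- The nodes v₁ , … , vₖ₋₁ of (v₀ , … , vₖ).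
  intermediates : ∀ {u v} → Path u v → List V
  intermediates [ _ ]                 = []
  intermediates (_ ∷ [ _ ])           = []
  intermediates (_∷_ {v = x} _ (a ∷ p)) = x ∷ intermediates (a ∷ p)

  -- Two paths are the same when their node sequences are; the proofs that
  -- successive nodes are joined by arcs are irrelevant.
  infix 4 _≋_
  _≋_ : ∀ {u v u′ v′} → Path u v → Path u′ v′ → Set
  p ≋ q = Pointwise _≈_ (sequence p) (sequence q)

  IsTheArc : ∀ {u v} → Path u v → Set
  IsTheArc {u} {v} p = Pointwise _≈_ (sequence p) (u ∷ v ∷ [])

  NoCommonIntermediate : ∀ {u v u′ v′} → Path u v → Path u′ v′ → Set
  NoCommonIntermediate p q = Disjoint nodes (intermediates p) (intermediates q)

  ExactlyOnePath : V → V → Set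
  ExactlyOnePath u v = Σ[ p ∈ Path u v ] (∀ (q : Path u v) → p ≋ q)

  IsRoot : V → Set
  IsRoot r = ∀ v → ¬ (v ≈ r) → ExactlyOnePath r v

record Tree : Set₁ where
  field
    digraph : Digraph
  open Digraph digraph public
  field
    loopless      : Irreflexive _≈_ _⟶_
    size          : ℕ
    finite        : Inverse nodes (setoid (Fin size))
    emptyOrRooted : (¬ V) ⊎ (∃[ r ] IsRoot r)

record MinorEmbedding (S T : Tree) : Set where
  private
    module S = Tree S
    module T = Tree T
  field
    injection : Injection S.nodes T.nodes
  open Injection injection public using (to; cong; injective)

  InImage : T.V → Set
  InImage x = ∃[ u ] (to u T.≈ x)

  field
    arc⇒path : ∀ {u v} → u S.⟶ v →
      Σ[ p ∈ T.Path (to u) (to v) ]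
        All (λ x → ¬ InImage x) (T.intermediates p)

record IsLargestCommonMinor (M T₁ T₂ : Tree) : Set₁ where
  field
    minor₁  : MinorEmbedding M T₁
    minor₂  : MinorEmbedding M T₂
    largest : ∀ (S : Tree) → MinorEmbedding S T₁ → MinorEmbedding S T₂ →
              Tree.size S ≤ Tree.size M

module _ {M T₁ T₂ : Tree}
         (g₁ : MinorEmbedding M T₁) (g₂ : MinorEmbedding M T₂) where
  private
    module M  = Tree M
    module T₁ = Tree T₁
    module T₂ = Tree T₂
    module g₁ = MinorEmbedding g₁
    module g₂ = MinorEmbedding g₂

  data θ : Rel (T₁.V ⊎ T₂.V) 0ℓ where
    same₁  : ∀ {a b} → a T₁.≈ b → θ (inj₁ a) (inj₁ b)
    same₂  : ∀ {a b} → a T₂.≈ b → θ (inj₂ a) (inj₂ b)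
    glue₁₂ : ∀ {a b} c → a T₁.≈ g₁.to c → b T₂.≈ g₂.to c →
             θ (inj₁ a) (inj₂ b)
    glue₂₁ : ∀ {a b} c → a T₁.≈ g₁.to c → b T₂.≈ g₂.to c →
             θ (inj₂ b) (inj₁ a)

  private
    θ-refl : ∀ {x} → θ x x
    θ-refl {inj₁ _} = same₁ T₁.refl
    θ-refl {inj₂ _} = same₂ T₂.refl

    θ-sym : ∀ {x y} → θ x y → θ y x
    θ-sym (same₁ e)       = same₁ (T₁.sym e)
    θ-sym (same₂ e)       = same₂ (T₂.sym e)
    θ-sym (glue₁₂ c e e′) = glue₂₁ c e e′
    θ-sym (glue₂₁ c e e′) = glue₁₂ c e e′

    θ-trans : ∀ {x y z} → θ x y → θ y z → θ x z
    θ-trans (same₁ e) (same₁ f)       = same₁ (T₁.trans e f)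
    θ-trans (same₁ e) (glue₁₂ c f f′) = glue₁₂ c (T₁.trans e f) f′
    θ-trans (same₂ e) (same₂ f)       = same₂ (T₂.trans e f)
    θ-trans (same₂ e) (glue₂₁ c f f′) = glue₂₁ c f (T₂.trans e f′)
    θ-trans (glue₁₂ c e e′) (same₂ f) = glue₁₂ c e (T₂.trans (T₂.sym f) e′)
    θ-trans (glue₁₂ c e e′) (glue₂₁ d f f′) =
      same₁ (T₁.trans e (T₁.trans
        (g₁.cong (g₂.injective (T₂.trans (T₂.sym e′) f′))) (T₁.sym f)))
    θ-trans (glue₂₁ c e e′) (same₁ f) = glue₂₁ c (T₁.trans (T₁.sym f) e) e′
    θ-trans (glue₂₁ c e e′) (glue₁₂ d f f′) =
      same₂ (T₂.trans e′ (T₂.trans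
        (g₂.cong (g₁.injective (T₁.trans (T₁.sym e) f))) (T₂.sym f′)))

  join : Digraph
  join = record
    { nodes  = record
      { Carrier       = T₁.V ⊎ T₂.V
      ; _≈_           = θ
      ; isEquivalence = record
        { refl = θ-refl ; sym = θ-sym ; trans = θ-trans }
      }
    ; _⟶_    = λ a b → ∃[ a′ ] ∃[ b′ ]
                 (θ a a′ × θ b b′ × Sum.Pointwise T₁._⟶_ T₂._⟶_ a′ b′)
    ; ⟶-resp = (λ e (a′ , b′ , p , q , arc) →
                  a′ , b′ , p , θ-trans (θ-sym e) q , arc)
             , (λ e (a′ , b′ , p , q , arc) →
                  a′ , b′ , θ-trans (θ-sym e) p , q , arc)
    }

{-# OPTIONS --safe #-}
-- T₁ has arcs 0→1, 1→2, 1→3 and T₂ has arcs 0→1, 1→2, 0→3; Tμ has arcs 0→1 and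
-- 0→2, and both embeddings avoid exactly the node 1.  In the join the two copies
-- of 1 stay distinct, so 0 reaches 2 through either of them.  A common minor with
-- four nodes would use every node of T₁ and of T₂, so its arcs would be arcs of
-- both; but T₁ has a non-root node with two children and T₂ has none.
module Submission where

open import Defs
open import Data.Empty using (⊥)
open import Data.Fin.Base using (Fin; zero; suc; toℕ; punchIn; punchOut; _<_)
open import Data.Fin.Induction using (<-wellFounded)
open import Data.Fin.Patterns using (0F; 1F; 2F; 3F)
open import Data.Fin.Properties
  using (all?; punchIn-injective; punchInᵢ≢i; punchOut-injective; injective⇒≤)
open import Data.List.Base using (List; []; _∷_; _++_; _∷ʳ_)
open import Data.List.Properties using (++-assoc)
open import Data.List.Relation.Binary.Pointwise using (≡⇒Pointwise-≡; []; _∷_)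
open import Data.List.Relation.Unary.All using (All; []; _∷_)
open import Data.List.Relation.Unary.Any using (here)
open import Data.Nat.Base as ℕ using (ℕ; suc; s≤s)
import Data.Nat.Properties as ℕ
open import Data.Product.Base using (Σ-syntax; ∃-syntax; _×_; _,_; proj₁; proj₂)
open import Data.Sum.Base using (inj₁; inj₂)
open import Data.Sum.Relation.Binary.Pointwise using (inj₁; inj₂)
import Data.Vec.Base as Vec
open import Function.Bundles using (Injection; module Inverse)
open import Function.Construct.Identity using (↔-id)
open import Induction.WellFounded using (Acc; acc)
open import Relation.Binary.PropositionalEquality
open import Relation.Nullary.Decidable using (from-yes; decidable-stable)
open import Relation.Nullary.Negation using (¬_; contradiction)

module _ (G : Digraph) where
  open Digraph G renaming (refl to ≈-refl; sym to ≈-sym)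

  snoc : ∀ {u v w} → Path u v → v ⟶ w → Path u w
  snoc [ u≈v ] v⟶w = proj₂ ⟶-resp (≈-sym u≈v) v⟶w ∷ [ ≈-refl ]
  snoc (a ∷ p) v⟶w = a ∷ snoc p v⟶w

  arcBefore : ∀ {u v w} → u ⟶ v → Path v w → ∃[ x ] x ⟶ w
  arcBefore {u} a [ v≈w ] = u , proj₁ ⟶-resp v≈w a
  arcBefore _ (b ∷ p)     = arcBefore b p

  -- Used on the path from the root, where it supplies a parent of any other node.
  lastArc : ∀ {u v} → ¬ (v ≈ u) → Path u v → ∃[ w ] w ⟶ v
  lastArc v≉u [ u≈v ] = contradiction (≈-sym u≈v) v≉u
  lastArc _   (a ∷ p) = arcBefore a p

-- The parent of `suc i` is `parent i`; as `parent≤` numbers parents below their children, every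
-- chain of parents ends at `zero`.
module ParentTree {n : ℕ} (parent : Fin n → Fin (suc n))
                  (parent≤ : ∀ i → toℕ (parent i) ℕ.≤ toℕ i) where

  Arc : Fin (suc n) → Fin (suc n) → Set
  Arc u zero    = ⊥
  Arc u (suc i) = u ≡ parent i

  digraph : Digraph
  digraph = record
    { nodes  = setoid (Fin (suc n))
    ; _⟶_    = Arc
    ; ⟶-resp = (λ { refl a → a }) , (λ { refl a → a })
    }

  open Digraph digraph using (Path; [_]; _∷_; sequence; IsRoot)

  -- The proper ancestors of a node, listed from the root downwards like the sequence of a path.
  data Ancestors : Fin (suc n) → List (Fin (suc n)) → Set where
    root : Ancestors zero []
    step : ∀ {i us} → Ancestors (parent i) us →
           Ancestors (suc i) (us ∷ʳ parent i)

  Ancestors-functional : ∀ {v us us′} →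
    Ancestors v us → Ancestors v us′ → us ≡ us′
  Ancestors-functional root     root      = refl
  Ancestors-functional (step a) (step a′) =
    cong (_∷ʳ _) (Ancestors-functional a a′)

  -- An arc into `suc i` can only start at its parent, so each arc of `p` extends the ancestor list
  -- by one `step`. For `u` the root the prefix `us` is empty, and the sequence of `p` depends on
  -- `v` alone: this gives uniqueness of root paths.
  Ancestors-path : ∀ {u v us vs} → Ancestors u us → Ancestors v vs →
    (p : Path u v) → us ++ sequence p ≡ vs ∷ʳ v
  Ancestors-path a b [ refl ] =
    cong (_∷ʳ _) (Ancestors-functional a b)
  Ancestors-path {us = us} a b (_∷_ {v = suc i} refl p) =
    trans (sym (++-assoc us _ _)) (Ancestors-path (step a) b p)

  ancestors : ∀ v → Acc _<_ v → ∃[ us ] Ancestors v us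
  ancestors zero    _         = [] , root
  ancestors (suc i) (acc rec) =
    _ , step (proj₂ (ancestors (parent i) (rec (s≤s (parent≤ i)))))

  pathFromRoot : ∀ {v us} → Ancestors v us → Path zero v
  pathFromRoot root     = [ refl ]
  pathFromRoot (step a) = snoc digraph (pathFromRoot a) refl

  zero-isRoot : IsRoot zero
  zero-isRoot v _ with ancestors v (<-wellFounded v)
  ... | _ , a = pathFromRoot a , λ q → ≡⇒Pointwise-≡
    (trans (Ancestors-path root a (pathFromRoot a)) (sym (Ancestors-path root a q)))

  Arc-irreflexive : ∀ {u v} → u ≡ v → ¬ Arc u v
  Arc-irreflexive {v = suc i} refl i≡p =
    ℕ.1+n≰n (subst (λ x → toℕ x ℕ.≤ toℕ i) (sym i≡p) (parent≤ i))

  tree : Tree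
  tree = record
    { digraph       = digraph
    ; loopless      = Arc-irreflexive
    ; size          = suc n
    ; finite        = ↔-id _
    ; emptyOrRooted = inj₂ (zero , zero-isRoot)
    }

  module _ {S : Tree} (f : MinorEmbedding S tree) where
    private module S = Tree S
    open MinorEmbedding f renaming (cong to to-cong)

    -- Removing `y` from the codomain leaves an injection into `Fin n`.
    missed⇒size≤ : ∀ {y} → ¬ InImage y → S.size ℕ.≤ n
    missed⇒size≤ {y} y∉ = injective⇒≤ {f = λ i → punchOut (y≢ i)} λ e →
      from-injective (injective (punchOut-injective (y≢ _) (y≢ _) e))
      where
      open Inverse S.finite using (from; inverseˡ)
      y≢ : ∀ i → y ≢ to (from i)
      y≢ i y≡ = y∉ (from i , sym y≡)
      from-injective : ∀ {i j} → from i S.≈ from j → i ≡ j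
      from-injective e = trans (sym (inverseˡ S.refl)) (inverseˡ e)

    module _ (size≰n : ¬ (S.size ℕ.≤ n)) where

      -- Double negation is enough, since every use ends in a contradiction.
      ¬¬surjective : ∀ y → ¬ ¬ InImage y
      ¬¬surjective y y∉ = size≰n (missed⇒size≤ y∉)

      -- An empty path would make the arc a loop, and an intermediate node would lie outside the
      -- image; only a single arc is left.
      arc⇒arc : ∀ {u v} → u S.⟶ v → Arc (to u) (to v)
      arc⇒arc u⟶v with arc⇒path u⟶v
      ... | [ e ]        , _      = contradiction u⟶v (S.loopless (injective e))
      ... | a ∷ [ refl ] , _      = a
      ... | _ ∷ _ ∷ _    , x∉ ∷ _ = contradiction x∉ (¬¬surjective _)

      -- If the root went to a nonzero node, the node over `zero` would have a parent, whose arc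
      -- would map to an arc into `zero`.
      ↦nonzero⇒≉root : ∀ {r v} → S.IsRoot r → to v ≢ zero → ¬ (v S.≈ r)
      ↦nonzero⇒≉root {r} r-root v≢0 v≈r = ¬¬surjective zero λ (u , u↦0) →
        let u≉r = λ u≈r → v≢0 (trans (to-cong (S.trans v≈r (S.sym u≈r))) u↦0)
            _ , w⟶u = lastArc S.digraph u≉r (proj₁ (r-root u u≉r))
        in subst (Arc _) u↦0 (arc⇒arc w⟶u)

      parentOf : ∀ v → to v ≢ zero → ∃[ w ] w S.⟶ v
      parentOf v v≢0 with S.emptyOrRooted
      ... | inj₁ empty        = contradiction v empty
      ... | inj₂ (r , r-root) = lastArc S.digraph v≉r (proj₁ (r-root v v≉r))
        where v≉r = ↦nonzero⇒≉root r-root v≢0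

module _ where
  open Vec using (_∷_; [])

  parent₁ parent₂ : Fin 3 → Fin 4
  parent₁ = Vec.lookup (0F ∷ 1F ∷ 1F ∷ [])
  parent₂ = Vec.lookup (0F ∷ 1F ∷ 0F ∷ [])

module P₁ = ParentTree parent₁ (from-yes (all? λ i → toℕ (parent₁ i) ℕ.≤? toℕ i))
module P₂ = ParentTree parent₂ (from-yes (all? λ i → toℕ (parent₂ i) ℕ.≤? toℕ i))
module Pμ = ParentTree {2} (λ _ → 0F) (λ _ → ℕ.z≤n)

avoid1 : Injection (setoid (Fin 3)) (setoid (Fin 4))
avoid1 = record
  { to        = punchIn 1F
  ; cong      = cong (punchIn 1F)
  ; injective = punchIn-injective 1F _ _
  }

1∉avoid1 : ¬ (Σ[ u ∈ Fin 3 ] punchIn 1F u ≡ 1F)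
1∉avoid1 (u , e) = punchInᵢ≢i 1F u e

embed₁ : MinorEmbedding Pμ.tree P₁.tree
embed₁ = record { injection = avoid1 ; arc⇒path = arc⇒path }
  where
  open Tree P₁.tree using (Path; [_]; _∷_; intermediates)
  arc⇒path : ∀ {u v} → Pμ.Arc u v → Σ[ p ∈ Path (punchIn 1F u) (punchIn 1F v) ]
             All (λ x → ¬ (∃[ c ] punchIn 1F c ≡ x)) (intermediates p)
  arc⇒path {v = 1F} refl = _∷_ {v = 1F} refl (refl ∷ [ refl ]) , 1∉avoid1 ∷ []
  arc⇒path {v = 2F} refl = _∷_ {v = 1F} refl (refl ∷ [ refl ]) , 1∉avoid1 ∷ []

embed₂ : MinorEmbedding Pμ.tree P₂.tree
embed₂ = record { injection = avoid1 ; arc⇒path = arc⇒path }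
  where
  open Tree P₂.tree using (Path; [_]; _∷_; intermediates)
  arc⇒path : ∀ {u v} → Pμ.Arc u v → Σ[ p ∈ Path (punchIn 1F u) (punchIn 1F v) ]
             All (λ x → ¬ (∃[ c ] punchIn 1F c ≡ x)) (intermediates p)
  arc⇒path {v = 1F} refl = _∷_ {v = 1F} refl (refl ∷ [ refl ]) , 1∉avoid1 ∷ []
  arc⇒path {v = 2F} refl = refl ∷ [ refl ] , []

-- The arc into `y` excludes the root, which has the two children 1 and 3; the only other node with
-- a child is 1.
onlyChild₂ : ∀ {x y z z′} → P₂.Arc x y → P₂.Arc y z → P₂.Arc y z′ → z ≡ z′
onlyChild₂ {z = 1F}           () refl _
onlyChild₂ {z = 3F}           () refl _
onlyChild₂ {z = 2F} {z′ = 2F} _  _    _ = refl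
onlyChild₂ {z = 2F} {z′ = 1F} _  refl ()
onlyChild₂ {z = 2F} {z′ = 3F} _  refl ()

commonMinor-size≤3 : ∀ S → MinorEmbedding S P₁.tree → MinorEmbedding S P₂.tree →
                     Tree.size S ℕ.≤ 3
commonMinor-size≤3 S f₁ f₂ = decidable-stable (_ ℕ.≤? 3) λ size≰3 →
  let parentOf = P₁.parentOf f₁ size≰3
      arc₁     = P₁.arc⇒arc f₁ size≰3
      arc₂     = P₂.arc⇒arc f₂ size≰3
  in
  P₁.¬¬surjective f₁ size≰3 2F λ (b , b↦2) →
  P₁.¬¬surjective f₁ size≰3 3F λ (c , c↦3) →
  let x  , x⟶b  = parentOf b (≢0 b↦2)
      x′ , x′⟶c = parentOf c (≢0 c↦3)
      x↦1  = subst (P₁.Arc _) b↦2 (arc₁ x⟶b)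
      x′↦1 = subst (P₁.Arc _) c↦3 (arc₁ x′⟶c)
      -- The parents of `b` and `c` both lie over node 1 of T₁, so they coincide.
      x⟶c  = proj₂ S.⟶-resp (f₁.injective (trans x′↦1 (sym x↦1))) x′⟶c
      -- This arc ensures that `f₂` does not send `x` to the root of T₂.
      _ , a⟶x = parentOf x (≢0 x↦1)
      b≈c = f₂.injective (onlyChild₂ (arc₂ a⟶x) (arc₂ x⟶b) (arc₂ x⟶c))
  in contradiction (trans (sym b↦2) (trans (f₁.cong b≈c) c↦3)) λ ()
  where
  module S  = Tree S
  module f₁ = MinorEmbedding f₁
  module f₂ = MinorEmbedding f₂
  ≢0 : ∀ {y : Fin 4} {i : Fin 3} → y ≡ suc i → y ≢ zero
  ≢0 refl ()

mainTheorem2 : Σ[ T₁ ∈ Tree ] Σ[ T₂ ∈ Tree ] Σ[ Tμ ∈ Tree ]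
    IsLargestCommonMinor Tμ T₁ T₂ ×
    (Σ[ g₁ ∈ MinorEmbedding Tμ T₁ ] Σ[ g₂ ∈ MinorEmbedding Tμ T₂ ]
    let open Digraph (join g₁ g₂) in
    ∃[ v ] ∃[ w ] Σ[ p ∈ Path v w ] Σ[ q ∈ Path v w ]
    (¬ (p ≋ q) × NoCommonIntermediate p q ×
    ¬ IsTheArc p × ¬ IsTheArc q))
mainTheorem2 =
  P₁.tree , P₂.tree , Pμ.tree ,
  record { minor₁ = embed₁ ; minor₂ = embed₂ ; largest = commonMinor-size≤3 } ,
  embed₁ , embed₂ , inj₁ 0F , inj₁ 2F , via₁ , via₂ ,
  (λ { (_ ∷ 1≈1 ∷ _) → 1≉1 1≈1 }) ,
  (λ { (here e , here e′) → 1≉1 (J.trans (J.sym e) e′) }) ,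
  (λ { (_ ∷ _ ∷ ()) }) , (λ { (_ ∷ _ ∷ ()) })
  where
  module J = Digraph (join embed₁ embed₂)
  open J using ([_]; _∷_)

  via₁ via₂ : J.Path (inj₁ 0F) (inj₁ 2F)
  via₁ = _∷_ {v = inj₁ 1F} (_ , _ , J.refl , J.refl , inj₁ refl)
       ( (_ , _ , J.refl , J.refl , inj₁ refl) ∷ [ J.refl ])
  -- The detour through T₂ leaves and re-enters T₁ at the glued nodes 0 and 2, the images of 0 and 1
  -- of Tμ.
  via₂ = _∷_ {v = inj₂ 1F} (_ , _ , glue₁₂ 0F refl refl , J.refl , inj₂ refl)
       ( (_ , _ , J.refl , glue₁₂ 1F refl refl , inj₂ refl) ∷ [ J.refl ])

  1≉1 : ¬ (inj₁ 1F J.≈ inj₂ 1F)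
  1≉1 (glue₁₂ c e _) = 1∉avoid1 (c , sym e)
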